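{- Let $b, t, n$ be positive integers with $t \ge b$. Then the set $\mathcal{H}_{b,t}(n)$ of hyper $(b,t)$-ary partitions of $n$, partially ordered by refinement, is a lattice.
   Context: A partition of a positive integer $n$ is a finite multiset $\lambda=\{\lambda_1\ge\cdots\ge\lambda_k\}$ of positive integers (its parts) with $\sum_i\lambda_i=n$. For positive integers $b,t$ with $t\ge b$, a hyper $(b,t)$-ary partition of $n$ is a partition of $n$ all of whose parts are powers $b^j$ of $b$ ($j\ge 0$, so $b^0=1$ is allowed), each part size occurring with multiplicity at most $t$. $\mathcal{H}_{b,t}(n)$ denotes the set of all hyper $(b,t)$-ary partitions of $n$. Refinement order: for partitions $\lambda,\mu$ of $n$, $\mu\le\lambda$ if the parts of $\mu$ can be obtained from $\lambda$ by combining parts, i.e. the multiset of parts of $\lambda$ can be divided into disjoint nonempty groups whose sums, taken as a multiset, are exactly the parts of $\mu$. $\mathcal{H}_{b,t}(n)$ carries the restriction of this order. A poset is a lattice if every pair of elements $x,y$ has a least upper bound $x\lor y$ and a greatest lower bound $x\land y$. -}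

module Defs where

open import Data.List.Base using (List; []; concat; filter; length; map)
open import Data.List.Relation.Binary.Permutation.Propositional using (_↭_)
open import Data.List.Relation.Unary.All using (All)
open import Data.Nat.Base using (ℕ; _≤_; _<_; _^_)
open import Data.Nat.ListAction using (sum)
open import Data.Nat.Properties using (_≟_)
open import Data.Product.Base using (∃-syntax; _×_)
open import Relation.Binary.PropositionalEquality.Core using (_≡_; _≢_)

multiplicity : ℕ → List ℕ → ℕ
multiplicity m xs = length (filter (m ≟_) xs)

-- A finite multiset is a list considered up to permutation, so the equality
-- of partitions is _≈ᴾ_ below and not propositional equality.
record Partition (n : ℕ) : Set where
  field
    parts    : List ℕ
    positive : All (0 <_) parts
    sum≡n    : sum parts ≡ n

open Partition public

_≈ᴾ_ : ∀ {n} → Partition n → Partition n → Set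
p ≈ᴾ q = parts p ↭ parts q

-- q ≤ᴾ p: the parts of q are obtained from p by combining parts, so finer
-- partitions are larger.
_≤ᴾ_ : ∀ {n} → Partition n → Partition n → Set
q ≤ᴾ p = ∃[ groups ]
  All (_≢ []) groups × concat groups ↭ parts p × map sum groups ↭ parts q

record HyperPartition (b t n : ℕ) : Set where
  field
    partition : Partition n
    powers    : All (λ x → ∃[ j ] x ≡ b ^ j) (parts partition)
    bounded   : ∀ m → multiplicity m (parts partition) ≤ t

open HyperPartition public

_≈ᴴ_ : ∀ {b t n} → HyperPartition b t n → HyperPartition b t n → Set
x ≈ᴴ y = partition x ≈ᴾ partition y

_≤ᴴ_ : ∀ {b t n} → HyperPartition b t n → HyperPartition b t n → Set
x ≤ᴴ y = partition x ≤ᴾ partition y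

infix 4 _≈ᴾ_ _≤ᴾ_ _≈ᴴ_ _≤ᴴ_

{-# OPTIONS --safe #-}
-- For b ≥ 2, encode a list of powers of b by its carries c k = Σ ⌊x / b ^ k⌋.
-- The multiplicity of b ^ k is c k - b * c (k + 1), so the hyper partitions
-- of n correspond to the sequences with c 0 = n, eventually zero, satisfying
--   b * c (k + 1) ≤ c k ≤ b * c (k + 1) + t,
-- and combining parts can only increase c.  Conversely, if the carries of q
-- dominate those of p, then q arises from p by working upwards through the
-- powers of b, merging parts b ^ k in batches of b.  So refinement is the
-- reverse of the pointwise order on c, and since the constraints are preserved
-- by pointwise minimum and maximum, these give join and meet.
-- For b = 1 all hyper partitions of n are equal.
module Submission where

open import Defs
open import Algebra.Core using (Op₂)
open import Algebra.Definitions using (Idempotent)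
open import Data.List.Base
  using (List; []; _∷_; [_]; _++_; concat; filter; length; map; replicate)
open import Data.List.Membership.Propositional using (_∈_)
open import Data.List.Membership.Propositional.Properties using (∈-∃++)
open import Data.List.Properties
  using (concat-++; concat-map-[_]; filter-accept; filter-all; filter-++; filter-none;
         filter-reject; length-++; length-replicate; map-++; map-cong; map-id; map-∘;
         ++-assoc; ++-identityʳ; ∷-injective)
open import Data.List.Relation.Binary.Permutation.Propositional
  using (_↭_; swap; ↭-refl; ↭-reflexive; ↭-sym; ↭-trans; prep)
open import Data.List.Relation.Binary.Permutation.Propositional.Properties
  using (All-resp-↭; filter-↭; shift; shifts; ↭-empty-inv; ↭-length; ↭-map-inv; ++⁺)
  renaming (map⁺ to ↭-map⁺)
open import Data.List.Relation.Unary.All as All using (All; []; _∷_)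
import Data.List.Relation.Unary.All.Properties as Allₚ
open import Data.List.Relation.Unary.Any using (here; there)
open import Data.Nat.Base
open import Data.Nat.DivMod
  using (_/_; m*n/n≡m; m/n*n≤m; m<n⇒m/n≡0; n/1≡n; /-congˡ; /-monoˡ-≤)
open import Data.Nat.ListAction using (sum)
open import Data.Nat.ListAction.Properties using (sum-++; sum-↭)
open import Data.Nat.Properties
open import Algebra.Properties.CommutativeSemigroup +-commutativeSemigroup using (interchange)
open import Data.Product.Base using (∃; ∃₂; ∃-syntax; _×_; _,_; proj₁; proj₂)
open import Data.Sum.Base using (inj₁; inj₂)
open import Function.Base using (_∘_)
open import Relation.Binary.Definitions using (tri<; tri≈; tri>)
open import Relation.Binary.Lattice.Structures using (IsLattice)
open import Relation.Binary.Structures using (IsPreorder)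
open import Relation.Binary.PropositionalEquality
  using (_≡_; _≢_; refl; sym; trans; cong; cong₂; subst; module ≡-Reasoning)
open import Relation.Nullary using (yes; no; contradiction)

-- Refinement of arbitrary lists of numbers.

infix 4 _≼_

-- The relation `_≤ᴴ_` unfolds to this one on `parts`. Working with raw lists allows intermediate
-- lists that carry no multiplicity bound.
_≼_ : List ℕ → List ℕ → Set
ys ≼ xs = ∃[ groups ]
  All (_≢ []) groups × concat groups ↭ xs × map sum groups ↭ ys

sum-concat : ∀ xss → sum (concat xss) ≡ sum (map sum xss)
sum-concat []         = refl
sum-concat (xs ∷ xss) = trans (sum-++ xs (concat xss)) (cong (sum xs +_) (sum-concat xss))

map-++⁻ : ∀ {A B : Set} (f : A → B) (ys : List B) {zs} xs → ys ++ zs ≡ map f xs →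
          ∃₂ λ us vs → us ++ vs ≡ xs × ys ≡ map f us × zs ≡ map f vs
map-++⁻ f []       xs       eq = [] , xs , refl , refl , eq
map-++⁻ f (y ∷ ys) (x ∷ xs) eq with refl , eq′ ← ∷-injective eq
  with us , vs , refl , refl , refl ← map-++⁻ f ys xs eq′ = x ∷ us , vs , refl , refl , refl

≼-reflexive : ∀ {xs ys} → ys ↭ xs → ys ≼ xs
≼-reflexive {xs} p =
  map [_] xs , Allₚ.map⁺ (All.universal (λ _ ()) xs) ,
  ↭-reflexive (concat-map-[ xs ]) ,
  ↭-trans (↭-reflexive (trans (sym (map-∘ xs)) (trans (map-cong +-identityʳ xs) (map-id xs))))
          (↭-sym p)

≼-resp-↭ : ∀ {xs xs′ ys ys′} → ys ↭ ys′ → xs ↭ xs′ → ys ≼ xs → ys′ ≼ xs′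
≼-resp-↭ p q (gs , ne , cat , sm) = gs , ne , ↭-trans cat q , ↭-trans sm p

≼-++⁺ : ∀ {xs xs′ ys ys′} → ys ≼ xs → ys′ ≼ xs′ → ys ++ ys′ ≼ xs ++ xs′
≼-++⁺ (gs , ne , cat , sm) (gs′ , ne′ , cat′ , sm′) =
  gs ++ gs′ , Allₚ.++⁺ ne ne′ ,
  ↭-trans (↭-reflexive (sym (concat-++ gs gs′))) (++⁺ cat cat′) ,
  ↭-trans (↭-reflexive (map-++ sum gs gs′)) (++⁺ sm sm′)

concat-↭ : ∀ {A : Set} {xss yss : List (List A)} → xss ↭ yss → concat xss ↭ concat yss
concat-↭ _↭_.refl = ↭-refl
concat-↭ (prep xs p) = ++⁺ (↭-refl {x = xs}) (concat-↭ p)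
concat-↭ (swap xs ys p) =
  ↭-trans (++⁺ (↭-refl {x = xs}) (++⁺ (↭-refl {x = ys}) (concat-↭ p))) (shifts xs ys)
concat-↭ (_↭_.trans p q) = ↭-trans (concat-↭ p) (concat-↭ q)

-- A permutation of `map sum gs` lifts to one of `gs`, so the groups can be listed in the order of
-- the parts they produce and cut where `ys` ends.
≼-++⁻ : ∀ ys {ys′ xs} → ys ++ ys′ ≼ xs → ∃₂ λ us vs → us ++ vs ↭ xs × ys ≼ us × ys′ ≼ vs
≼-++⁻ ys (gs , ne , cat , sm) with ↭-map-inv sum sm
... | gs′ , eq , p with map-++⁻ sum ys gs′ eq
... | us , vs , refl , refl , refl =
  concat us , concat vs ,
  ↭-trans (↭-reflexive (concat-++ us vs)) (↭-trans (concat-↭ (↭-sym p)) cat) ,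
  (us , Allₚ.++⁻ˡ us ne′ , ↭-refl , ↭-refl) ,
  (vs , Allₚ.++⁻ʳ us ne′ , ↭-refl , ↭-refl)
  where ne′ = All-resp-↭ p ne

≼-sum : ∀ {xs ys} → ys ≼ xs → sum ys ≡ sum xs
≼-sum (gs , _ , cat , sm) =
  trans (sym (sum-↭ sm)) (trans (sym (sum-concat gs)) (sum-↭ cat))

≼[]⇒≡[] : ∀ {ys} → ys ≼ [] → ys ≡ []
≼[]⇒≡[] ([] , _ , _ , sm) = ↭-empty-inv (↭-sym sm)
≼[]⇒≡[] ([] ∷ _ , ne ∷ _ , _) = contradiction refl ne
≼[]⇒≡[] ((_ ∷ _) ∷ _ , _ , cat , _) = contradiction (↭-length cat) λ ()

-- Transitivity with the middle and the coarse list in literal form. Each group `g` is refined by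
-- some portion `us` of `xs` with the same sum, so `us` itself can serve as the group producing
-- `sum g`.
≼-merge : ∀ {xs} gs → All (_≢ []) gs → concat gs ≼ xs → map sum gs ≼ xs
≼-merge []       []        p = p
≼-merge (g ∷ gs) (ne ∷ nes) p with ≼-++⁻ g p
... | us , vs , q , g≼us , gs≼vs =
  ≼-resp-↭ ↭-refl q (≼-++⁺ single (≼-merge gs nes gs≼vs))
  where
  single : [ sum g ] ≼ us
  -- An empty `us` would force `g` to be empty.
  single = [ us ] , (λ { refl → ne (≼[]⇒≡[] g≼us) }) ∷ [] ,
           ↭-reflexive (++-identityʳ us) , ↭-reflexive (cong [_] (sym (≼-sum g≼us)))

≼-trans : ∀ {xs ys zs} → zs ≼ ys → ys ≼ xs → zs ≼ xs
≼-trans (gs , ne , cat , sm) p =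
  ≼-resp-↭ sm ↭-refl (≼-merge gs ne (≼-resp-↭ (↭-sym cat) ↭-refl p))

-- Repeated parts and multiplicities.

replicate-+ : ∀ {A : Set} m n {x : A} → replicate (m + n) x ≡ replicate m x ++ replicate n x
replicate-+ zero    n = refl
replicate-+ (suc m) n = cong (_ ∷_) (replicate-+ m n)

sum-replicate : ∀ n x → sum (replicate n x) ≡ n * x
sum-replicate zero    x = refl
sum-replicate (suc n) x = cong (x +_) (sum-replicate n x)

-- One merging round: `n` groups of `m` equal parts each, nonempty because `m` is nonzero.
≼-replicate : ∀ m .{{_ : NonZero m}} n {x} → replicate n (m * x) ≼ replicate (n * m) x
≼-replicate m       zero    = ≼-reflexive ↭-refl
≼-replicate m@(suc _) (suc n) {x} =
  ≼-resp-↭ ↭-refl (↭-reflexive (sym (replicate-+ m (n * m))))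
    (≼-++⁺ {xs = replicate m x} {ys = [ m * x ]}
      ([ replicate m x ] , (λ ()) ∷ [] , ↭-reflexive (++-identityʳ _) ,
        ↭-reflexive (cong [_] (sum-replicate m x)))
      (≼-replicate m n))

multiplicity-++ : ∀ v xs ys →
                  multiplicity v (xs ++ ys) ≡ multiplicity v xs + multiplicity v ys
multiplicity-++ v xs ys =
  trans (cong length (filter-++ (v ≟_) xs ys)) (length-++ (filter (v ≟_) xs))

multiplicity-↭ : ∀ v {xs ys} → xs ↭ ys → multiplicity v xs ≡ multiplicity v ys
multiplicity-↭ v p = ↭-length (filter-↭ (v ≟_) p)

multiplicity-here : ∀ v xs → multiplicity v (v ∷ xs) ≡ suc (multiplicity v xs)
multiplicity-here v xs = cong length (filter-accept (v ≟_) {x = v} {xs = xs} refl)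

multiplicity-none : ∀ {v xs} → All (v ≢_) xs → multiplicity v xs ≡ 0
multiplicity-none {v} ps = cong length (filter-none (v ≟_) ps)

multiplicity-replicate : ∀ v n → multiplicity v (replicate n v) ≡ n
multiplicity-replicate v n =
  trans (cong length (filter-all (v ≟_) (Allₚ.replicate⁺ n refl))) (length-replicate n)

multiplicity>0⇒∈ : ∀ v xs → 0 < multiplicity v xs → v ∈ xs
multiplicity>0⇒∈ v (x ∷ xs) pos with v ≟ x
... | yes v≡x = here v≡x
... | no  v≢x = there (multiplicity>0⇒∈ v xs
        (subst (0 <_) (cong length (filter-reject (v ≟_) {xs = xs} v≢x)) pos))

-- The head of `xs` must occur in `ys`; delete it from both and recurse. The predicate `P` limits
-- the comparison to values that can occur, later the powers of `b`.
↭-fromMultiplicity : ∀ {P : ℕ → Set} {xs ys} → All P xs → All P ys →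
                     (∀ v → P v → multiplicity v xs ≡ multiplicity v ys) → xs ↭ ys
↭-fromMultiplicity {ys = []}     []  []       eq = ↭-refl
↭-fromMultiplicity {ys = y ∷ ys} []  (py ∷ _) eq =
  contradiction (trans (eq y py) (multiplicity-here y ys)) λ ()
↭-fromMultiplicity {xs = x ∷ xs} {ys} (px ∷ pxs) pys eq
  with us , vs , refl ← ∈-∃++ (multiplicity>0⇒∈ x ys
         (subst (0 <_) (trans (sym (multiplicity-here x xs)) (eq x px)) z<s)) =
  ↭-trans (prep x (↭-fromMultiplicity pxs (All.tail (All-resp-↭ sh pys)) eq′)) (↭-sym sh)
  where
  sh = shift x us vs
  open ≡-Reasoning
  eq′ : ∀ v → _ → multiplicity v xs ≡ multiplicity v (us ++ vs)
  eq′ v pv = +-cancelˡ-≡ (multiplicity v [ x ]) _ _ (begin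
    multiplicity v [ x ] + multiplicity v xs          ≡⟨ multiplicity-++ v [ x ] xs ⟨
    multiplicity v (x ∷ xs)                           ≡⟨ eq v pv ⟩
    multiplicity v (us ++ [ x ] ++ vs)                ≡⟨ multiplicity-↭ v sh ⟩
    multiplicity v (x ∷ us ++ vs)                     ≡⟨ multiplicity-++ v [ x ] (us ++ vs) ⟩
    multiplicity v [ x ] + multiplicity v (us ++ vs)  ∎)

-- Sums of floors under refinement.

quotientSum : ∀ d .{{_ : NonZero d}} → List ℕ → ℕ
quotientSum d xs = sum (map (_/ d) xs)

-- The largest multiples of `d` below `m` and below `n` add up to a multiple of `d` that is at most
-- `m + n`.
/-superadditive : ∀ m n d .{{_ : NonZero d}} → m / d + n / d ≤ (m + n) / d
/-superadditive m n d = begin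
  m / d + n / d              ≡⟨ m*n/n≡m (m / d + n / d) d ⟨
  (m / d + n / d) * d / d    ≡⟨ /-congˡ (*-distribʳ-+ d (m / d) (n / d)) ⟩
  (m / d * d + n / d * d) / d ≤⟨ /-monoˡ-≤ d (+-mono-≤ (m/n*n≤m m d) (m/n*n≤m n d)) ⟩
  (m + n) / d                ∎
  where open ≤-Reasoning

module _ (d : ℕ) .{{_ : NonZero d}} where

  quotientSum-++ : ∀ xs ys → quotientSum d (xs ++ ys) ≡ quotientSum d xs + quotientSum d ys
  quotientSum-++ xs ys = trans (cong sum (map-++ (_/ d) xs ys)) (sum-++ (map (_/ d) xs) _)

  quotientSum-↭ : ∀ {xs ys} → xs ↭ ys → quotientSum d xs ≡ quotientSum d ys
  quotientSum-↭ p = sum-↭ (↭-map⁺ (_/ d) p)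

  quotientSum≤sum/ : ∀ xs → quotientSum d xs ≤ sum xs / d
  quotientSum≤sum/ []       = z≤n
  quotientSum≤sum/ (x ∷ xs) =
    ≤-trans (+-monoʳ-≤ (x / d) (quotientSum≤sum/ xs)) (/-superadditive x (sum xs) d)

  quotientSum-concat : ∀ xss → quotientSum d (concat xss) ≤ quotientSum d (map sum xss)
  quotientSum-concat []         = z≤n
  quotientSum-concat (xs ∷ xss) =
    ≤-trans (≤-reflexive (quotientSum-++ xs (concat xss)))
            (+-mono-≤ (quotientSum≤sum/ xs) (quotientSum-concat xss))

  quotientSum-≼ : ∀ {xs ys} → ys ≼ xs → quotientSum d xs ≤ quotientSum d ys
  quotientSum-≼ (gs , _ , cat , sm) =
    ≤-trans (≤-reflexive (sym (quotientSum-↭ cat)))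
            (≤-trans (quotientSum-concat gs) (≤-reflexive (quotientSum-↭ sm)))

≤ᴴ-isPreorder : ∀ {b t n} → IsPreorder (_≈ᴴ_ {b} {t} {n}) _≤ᴴ_
≤ᴴ-isPreorder = record
  { isEquivalence = record { refl = ↭-refl ; sym = ↭-sym ; trans = ↭-trans }
  ; reflexive     = ≼-reflexive
  ; trans         = ≼-trans
  }

-- Carries of lists of powers of a base at least 2.

module Base (b : ℕ) (1<b : 1 < b) where

  private instance
    b≢0 : NonZero b
    b≢0 = >-nonZero (<-trans z<s 1<b)

  IsPower : ℕ → Set
  IsPower x = ∃[ j ] x ≡ b ^ j

  n<b^n : ∀ n → n < b ^ n
  n<b^n zero    = z<s
  n<b^n (suc n) = <-≤-trans (s<s (n<b^n n)) (^-monoʳ-< b 1<b (n<1+n n))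

  b^-injective : ∀ {j k} → b ^ j ≡ b ^ k → j ≡ k
  b^-injective {j} {k} eq with <-cmp j k
  ... | tri< j<k _ _ = contradiction eq (<⇒≢ (^-monoʳ-< b 1<b j<k))
  ... | tri≈ _ j≡k _ = j≡k
  ... | tri> _ _ k<j = contradiction (sym eq) (<⇒≢ (^-monoʳ-< b 1<b k<j))

  infixl 7 _/b^_

  _/b^_ : ℕ → ℕ → ℕ
  x /b^ k = _/_ x (b ^ k) {{m^n≢0 b k}}

  carry : ℕ → List ℕ → ℕ
  carry k = quotientSum (b ^ k) {{m^n≢0 b k}}

  carry-0 : ∀ xs → carry 0 xs ≡ sum xs
  carry-0 xs = cong sum (trans (map-cong n/1≡n xs) (map-id xs))

  -- The carry is at most `sum xs / b ^ k`, and `sum xs ≤ k < b ^ k`. The sum itself thus serves as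
  -- a crude but explicit cutoff index.
  carry-vanishes : ∀ {k} xs → sum xs ≤ k → carry k xs ≡ 0
  carry-vanishes {k} xs s≤k = n≤0⇒n≡0 (≤-trans (quotientSum≤sum/ (b ^ k) {{m^n≢0 b k}} xs)
    (≤-reflexive (m<n⇒m/n≡0 {{m^n≢0 b k}} (≤-<-trans s≤k (n<b^n k)))))

  b^j/b^k≡0 : ∀ {j k} → j < k → b ^ j /b^ k ≡ 0
  b^j/b^k≡0 {k = k} j<k = m<n⇒m/n≡0 {{m^n≢0 b k}} (^-monoʳ-< b 1<b j<k)

  b^[i+k]/b^k≡b^i : ∀ i k → b ^ (i + k) /b^ k ≡ b ^ i
  b^[i+k]/b^k≡b^i i k =
    trans (cong (_/b^ k) (^-distribˡ-+-* b i k)) (m*n/n≡m (b ^ i) (b ^ k) {{m^n≢0 b k}})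

  -- The difference between `x /b^ k` and `b * (x /b^ suc k)` is the base-`b` digit of `x` at place
  -- `k`, and `b ^ j` has the single nonzero digit 1, at place `j`.
  power-carry : ∀ j k →
                b ^ j /b^ k ≡ multiplicity (b ^ k) [ b ^ j ] + b * (b ^ j /b^ suc k)
  power-carry j k with <-cmp j k
  ... | tri< j<k j≢k _ = begin
    b ^ j /b^ k                   ≡⟨ b^j/b^k≡0 j<k ⟩
    0                             ≡⟨ *-zeroʳ b ⟨
    b * 0                         ≡⟨ cong₂ (λ u v → u + b * v)
                                       (multiplicity-none ((j≢k ∘ sym ∘ b^-injective) ∷ []))
                                       (b^j/b^k≡0 (m<n⇒m<1+n j<k)) ⟨
    multiplicity (b ^ k) [ b ^ j ] + b * (b ^ j /b^ suc k) ∎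
    where open ≡-Reasoning
  ... | tri≈ _ refl _ = begin
    b ^ k /b^ k                   ≡⟨ b^[i+k]/b^k≡b^i 0 k ⟩
    1                             ≡⟨ cong suc (*-zeroʳ b) ⟨
    1 + b * 0                     ≡⟨ cong₂ (λ u v → u + b * v)
                                       (multiplicity-here (b ^ k) [])
                                       (b^j/b^k≡0 (n<1+n k)) ⟨
    multiplicity (b ^ k) [ b ^ k ] + b * (b ^ k /b^ suc k) ∎
    where open ≡-Reasoning
  ... | tri> _ j≢k k<j = begin
    b ^ j /b^ k                   ≡⟨ cong (λ e → b ^ e /b^ k) (trans (sym (+-suc i k)) i+k≡j) ⟨
    b ^ (suc i + k) /b^ k         ≡⟨ b^[i+k]/b^k≡b^i (suc i) k ⟩
    b * b ^ i                     ≡⟨ cong (b *_) (b^[i+k]/b^k≡b^i i (suc k)) ⟨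
    b * (b ^ (i + suc k) /b^ suc k) ≡⟨ cong₂ (λ u e → u + b * (b ^ e /b^ suc k))
                                       (sym (multiplicity-none ((j≢k ∘ sym ∘ b^-injective) ∷ [])))
                                       i+k≡j ⟩
    multiplicity (b ^ k) [ b ^ j ] + b * (b ^ j /b^ suc k) ∎
    where
    open ≡-Reasoning
    -- Since `j` is both `i + suc k` and `suc i + k`, both divisions are exact.
    i = j ∸ suc k
    i+k≡j : i + suc k ≡ j
    i+k≡j = m∸n+n≡m k<j

  -- All terms are additive in the list, so `power-carry` can be summed over the parts. Through this
  -- recurrence carries and multiplicities determine each other.
  carry-rec : ∀ {xs} → All IsPower xs → ∀ k →
              carry k xs ≡ multiplicity (b ^ k) xs + b * carry (suc k) xs
  carry-rec []                            k = sym (*-zeroʳ b)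
  carry-rec {x ∷ xs} ((j , refl) ∷ ps) k = begin
    x /b^ k + carry k xs
      ≡⟨ cong₂ _+_ (power-carry j k) (carry-rec ps k) ⟩
    (μ [ x ] + b * (x /b^ suc k)) + (μ xs + b * carry (suc k) xs)
      ≡⟨ interchange (μ [ x ]) _ (μ xs) _ ⟩
    (μ [ x ] + μ xs) + (b * (x /b^ suc k) + b * carry (suc k) xs)
      ≡⟨ cong₂ _+_ (multiplicity-++ (b ^ k) [ x ] xs) (*-distribˡ-+ b (x /b^ suc k) _) ⟨
    μ (x ∷ xs) + b * carry (suc k) (x ∷ xs) ∎
    where
    open ≡-Reasoning
    μ = multiplicity (b ^ k)

  -- The carries at `k` and `suc k` give the multiplicity of `b ^ k` by `carry-rec`. This is the
  -- source of antisymmetry.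
  carry-determines : ∀ {xs ys} → All IsPower xs → All IsPower ys →
                     (∀ k → carry k xs ≡ carry k ys) → xs ↭ ys
  carry-determines {xs} {ys} ps qs eq = ↭-fromMultiplicity ps qs λ where
      _ (k , refl) → +-cancelʳ-≡ (b * carry (suc k) xs) _ _ (begin
        multiplicity (b ^ k) xs + b * carry (suc k) xs ≡⟨ carry-rec ps k ⟨
        carry k xs                                     ≡⟨ eq k ⟩
        carry k ys                                     ≡⟨ carry-rec qs k ⟩
        multiplicity (b ^ k) ys + b * carry (suc k) ys ≡⟨ cong (λ c → _ + b * c) (eq (suc k)) ⟨
        multiplicity (b ^ k) ys + b * carry (suc k) xs ∎)
    where open ≡-Reasoning

  -- Lists with prescribed multiplicities, and refinement from dominated carries.

  expand : (ℕ → ℕ) → ℕ → List ℕ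
  expand m zero    = []
  expand m (suc N) = expand m N ++ replicate (m N) (b ^ N)

  expand-powers : ∀ m N → All IsPower (expand m N)
  expand-powers m zero    = []
  expand-powers m (suc N) = Allₚ.++⁺ (expand-powers m N) (Allₚ.replicate⁺ (m N) (N , refl))

  multiplicity-replicate-≢ : ∀ {j k} → j ≢ k → ∀ i → multiplicity (b ^ k) (replicate i (b ^ j)) ≡ 0
  multiplicity-replicate-≢ j≢k i =
    multiplicity-none (Allₚ.replicate⁺ i (j≢k ∘ sym ∘ b^-injective))

  multiplicity-expand-≥ : ∀ m {k} N → N ≤ k → multiplicity (b ^ k) (expand m N) ≡ 0
  multiplicity-expand-≥ m     zero    _   = refl
  multiplicity-expand-≥ m {k} (suc N) N<k =
    trans (multiplicity-++ (b ^ k) (expand m N) _)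
      (cong₂ _+_ (multiplicity-expand-≥ m N (<⇒≤ N<k)) (multiplicity-replicate-≢ (<⇒≢ N<k) (m N)))

  multiplicity-expand-< : ∀ m {k} N → k < N → multiplicity (b ^ k) (expand m N) ≡ m k
  multiplicity-expand-< m {k} (suc N) k<1+N
    rewrite multiplicity-++ (b ^ k) (expand m N) (replicate (m N) (b ^ N))
    with m<1+n⇒m<n∨m≡n k<1+N
  ... | inj₁ k<N rewrite multiplicity-replicate-≢ (<⇒≢ k<N ∘ sym) (m N) =
    trans (+-identityʳ _) (multiplicity-expand-< m N k<N)
  ... | inj₂ refl rewrite multiplicity-expand-≥ m N ≤-refl = multiplicity-replicate (b ^ N) (m N)

  multiplicity-expand : ∀ {m N} → (∀ {k} → N ≤ k → m k ≡ 0) →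
                        ∀ k → multiplicity (b ^ k) (expand m N) ≡ m k
  multiplicity-expand {m} {N} m≡0 k with <-≤-connex k N
  ... | inj₁ k<N = multiplicity-expand-< m N k<N
  ... | inj₂ N≤k = trans (multiplicity-expand-≥ m N N≤k) (sym (m≡0 N≤k))

  expand-multiplicity : ∀ {xs N} → All IsPower xs → sum xs ≤ N →
                        xs ↭ expand (λ k → multiplicity (b ^ k) xs) N
  expand-multiplicity {xs} {N} ps s≤N = ↭-fromMultiplicity ps (expand-powers _ N) λ where
      _ (k , refl) → sym (multiplicity-expand vanish k)
    where
    -- A multiplicity is a summand of the carry at the same index, and that carry is zero from
    -- `sum xs` on.
    vanish : ∀ {k} → N ≤ k → multiplicity (b ^ k) xs ≡ 0
    vanish {k} N≤k =
      m+n≡0⇒m≡0 _ (trans (sym (carry-rec ps k)) (carry-vanishes xs (≤-trans s≤N N≤k)))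

  -- A telescoping invariant: `c N * b ^ N` is the share of the total not yet listed, and each step
  -- moves `m N * b ^ N` from it into the list.
  sum-expand : ∀ {m c : ℕ → ℕ} → (∀ k → c k ≡ m k + b * c (suc k)) →
               ∀ N → sum (expand m N) + c N * b ^ N ≡ c 0
  sum-expand {c = c} rec zero = *-identityʳ (c 0)
  sum-expand {m} {c} rec (suc N) = begin
    sum (expand m N ++ replicate (m N) (b ^ N)) + c (suc N) * (b * b ^ N)
      ≡⟨ cong₂ _+_ (sum-++ (expand m N) _) (sym (*-assoc (c (suc N)) b (b ^ N))) ⟩
    sum (expand m N) + sum (replicate (m N) (b ^ N)) + c (suc N) * b * b ^ N
      ≡⟨ cong₂ (λ u v → sum (expand m N) + u + v * b ^ N)
           (sum-replicate (m N) (b ^ N)) (*-comm (c (suc N)) b) ⟩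
    sum (expand m N) + m N * b ^ N + b * c (suc N) * b ^ N
      ≡⟨ +-assoc (sum (expand m N)) _ _ ⟩
    sum (expand m N) + (m N * b ^ N + b * c (suc N) * b ^ N)
      ≡⟨ cong (sum (expand m N) +_) (*-distribʳ-+ (b ^ N) (m N) _) ⟨
    sum (expand m N) + (m N + b * c (suc N)) * b ^ N
      ≡⟨ cong (λ u → sum (expand m N) + u * b ^ N) (rec N) ⟨
    sum (expand m N) + c N * b ^ N
      ≡⟨ sum-expand rec N ⟩
    c 0 ∎
    where open ≡-Reasoning

  -- d k counts the parts b ^ k that have been created by merging smaller ones.
  expand-≼ : ∀ {m m′ d : ℕ → ℕ} → d 0 ≡ 0 → (∀ k → d k + m k ≡ m′ k + b * d (suc k)) →
             ∀ N → expand m′ N ++ replicate (d N) (b ^ N) ≼ expand m N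
  expand-≼ d0≡0 rec zero rewrite d0≡0 = ≼-reflexive ↭-refl
  expand-≼ {m} {m′} {d} d0≡0 rec (suc N) =
    -- From the inside out: the recursive call settles the powers below `b ^ N`, `regroup` splits
    -- the copies of `b ^ N` into the `m′ N` that stay and the `d (suc N) * b` that move on, and
    -- `merged` fuses the latter in batches of `b`.
    ≼-trans merged
      (≼-trans (≼-reflexive (↭-reflexive regroup))
        (≼-++⁺ (expand-≼ d0≡0 rec N) (≼-reflexive ↭-refl)))
    where
    open ≡-Reasoning
    r : ℕ → List ℕ
    r i = replicate i (b ^ N)
    regroup : (expand m′ N ++ r (m′ N)) ++ r (d (suc N) * b) ≡ (expand m′ N ++ r (d N)) ++ r (m N)
    regroup = begin
      (expand m′ N ++ r (m′ N)) ++ r (d (suc N) * b)  ≡⟨ ++-assoc (expand m′ N) _ _ ⟩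
      expand m′ N ++ r (m′ N) ++ r (d (suc N) * b)    ≡⟨ cong (expand m′ N ++_) (replicate-+ (m′ N) _) ⟨
      expand m′ N ++ r (m′ N + d (suc N) * b)         ≡⟨ cong (λ i → expand m′ N ++ r (m′ N + i))
                                                           (*-comm (d (suc N)) b) ⟩
      expand m′ N ++ r (m′ N + b * d (suc N))         ≡⟨ cong (λ i → expand m′ N ++ r i) (rec N) ⟨
      expand m′ N ++ r (d N + m N)                    ≡⟨ cong (expand m′ N ++_) (replicate-+ (d N) _) ⟩
      expand m′ N ++ r (d N) ++ r (m N)               ≡⟨ ++-assoc (expand m′ N) _ _ ⟨
      (expand m′ N ++ r (d N)) ++ r (m N)             ∎
    merged : expand m′ (suc N) ++ replicate (d (suc N)) (b ^ suc N) ≼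
             expand m′ (suc N) ++ r (d (suc N) * b)
    merged = ≼-++⁺ {ys = expand m′ (suc N)} (≼-reflexive ↭-refl) (≼-replicate b (d (suc N)))

  -- Take for `d` in `expand-≼` the excess of the carries of `ys` over those of `xs`. The difference
  -- of the two carry recurrences is the required balance, and equal sums give `d 0 ≡ 0`.
  carry-≤⇒≼ : ∀ {xs ys} → All IsPower xs → All IsPower ys → sum xs ≡ sum ys →
              (∀ k → carry k xs ≤ carry k ys) → ys ≼ xs
  carry-≤⇒≼ {xs} {ys} ps qs sum≡ le =
    ≼-resp-↭ (↭-trans (↭-reflexive noCarry)
                      (↭-sym (expand-multiplicity qs (≤-reflexive (sym sum≡)))))
             (↭-sym (expand-multiplicity ps ≤-refl))
             (expand-≼ {d = d} d0≡0 rec N)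
    where
    N = sum xs
    d : ℕ → ℕ
    d k = carry k ys ∸ carry k xs
    m m′ : ℕ → ℕ
    m  k = multiplicity (b ^ k) xs
    m′ k = multiplicity (b ^ k) ys
    d0≡0 : d 0 ≡ 0
    d0≡0 rewrite carry-0 xs | carry-0 ys | sum≡ = n∸n≡0 (sum ys)
    -- The cutoff `N` is also the sum of `ys`, whose carry there is zero; hence no merged parts are
    -- left over.
    noCarry : expand m′ N ++ replicate (d N) (b ^ N) ≡ expand m′ N
    noCarry rewrite carry-vanishes {N} ys (≤-reflexive (sym sum≡)) | 0∸n≡0 (carry N xs) =
      ++-identityʳ _
    rec : ∀ k → d k + m k ≡ m′ k + b * d (suc k)
    -- Adding the carry of `xs` back on both sides lets `le` at `k` and at `suc k` undo the
    -- truncated subtractions in `d`.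
    rec k = +-cancelʳ-≡ (b * carry (suc k) xs) _ _ (begin
      d k + m k + b * carry (suc k) xs              ≡⟨ +-assoc (d k) _ _ ⟩
      d k + (m k + b * carry (suc k) xs)            ≡⟨ cong (d k +_) (carry-rec ps k) ⟨
      d k + carry k xs                              ≡⟨ m∸n+n≡m (le k) ⟩
      carry k ys                                    ≡⟨ carry-rec qs k ⟩
      m′ k + b * carry (suc k) ys                   ≡⟨ cong (λ c → m′ k + b * c) (m∸n+n≡m (le (suc k))) ⟨
      m′ k + b * (d (suc k) + carry (suc k) xs)     ≡⟨ cong (m′ k +_) (*-distribˡ-+ b (d (suc k)) _) ⟩
      m′ k + (b * d (suc k) + b * carry (suc k) xs) ≡⟨ +-assoc (m′ k) _ _ ⟨
      m′ k + b * d (suc k) + b * carry (suc k) xs   ∎)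
      where open ≡-Reasoning

  -- Carry sequences and the lattice operations for a base at least 2.

  module _ {t n : ℕ} where

    -- Eventual vanishing is stated with the fixed cutoff `n`: all sequences share it, so pointwise
    -- operations preserve it and `fromCarries` can truncate there.
    record IsCarrySequence (c : ℕ → ℕ) : Set where
      field
        start    : c 0 ≡ n
        vanishes : ∀ {k} → n ≤ k → c k ≡ 0
        lower    : ∀ k → b * c (suc k) ≤ c k
        upper    : ∀ k → c k ≤ b * c (suc k) + t

    carries : HyperPartition b t n → ℕ → ℕ
    carries x k = carry k (parts (partition x))

    carries-isCarrySequence : ∀ x → IsCarrySequence (carries x)
    carries-isCarrySequence x = record
      { start    = trans (carry-0 xs) (sum≡n (partition x))
      ; vanishes = λ n≤k → carry-vanishes xs (≤-trans (≤-reflexive (sum≡n (partition x))) n≤k)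
      ; lower    = λ k → subst (b * carry (suc k) xs ≤_) (sym (carry-rec (powers x) k)) (m≤n+m _ (μ k))
      ; upper    = λ k → subst (_≤ b * carry (suc k) xs + t)
                           (trans (+-comm (b * carry (suc k) xs) (μ k)) (sym (carry-rec (powers x) k)))
                           (+-monoʳ-≤ (b * carry (suc k) xs) (bounded x (b ^ k)))
      }
      where
      xs = parts (partition x)
      μ : ℕ → ℕ
      μ k = multiplicity (b ^ k) xs

    fromCarries : ∀ {c} → IsCarrySequence c → ∃ λ x → ∀ k → carries x k ≡ c k
    fromCarries {c} isC = x , carries≡c
      where
      open IsCarrySequence isC
      open ≡-Reasoning
      m : ℕ → ℕ
      m k = c k ∸ b * c (suc k)
      xs = expand m n
      rec : ∀ k → c k ≡ m k + b * c (suc k)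
      rec k = sym (m∸n+n≡m (lower k))
      mult : ∀ k → multiplicity (b ^ k) xs ≡ m k
      mult = multiplicity-expand λ {k} n≤k →
        trans (cong (_∸ b * c (suc k)) (vanishes n≤k)) (0∸n≡0 (b * c (suc k)))
      sum≡ : sum xs ≡ n
      sum≡ = begin
        sum xs                  ≡⟨ +-identityʳ (sum xs) ⟨
        sum xs + 0              ≡⟨ cong (λ i → sum xs + i * b ^ n) (vanishes ≤-refl) ⟨
        sum xs + c n * b ^ n    ≡⟨ sum-expand rec n ⟩
        c 0                     ≡⟨ start ⟩
        n                       ∎
      -- The bound is demanded for every `v`, but a multiplicity above `t` is positive, so such a
      -- `v` occurs in `xs` and is a power of `b`.
      bound : ∀ v → multiplicity v xs ≤ t
      bound v with multiplicity v xs ≤? t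
      ... | yes le = le
      ... | no  ≰ with All.lookup (expand-powers m n) (multiplicity>0⇒∈ v xs (m<n⇒0<n (≰⇒> ≰)))
      ... | k , refl = subst (_≤ t) (sym (mult k)) (m≤n+o⇒m∸n≤o (c k) (b * c (suc k)) (upper k))
      x : HyperPartition b t n
      x = record
        { partition = record
          { parts    = xs
          ; positive = All.map (λ { (j , refl) → m^n>0 b j }) (expand-powers m n)
          ; sum≡n    = sum≡
          }
        ; powers  = expand-powers m n
        ; bounded = bound
        }
      -- Both sequences start at `n` and obey the same recurrence; as `b` is nonzero, each term
      -- determines the next.
      carries≡c : ∀ k → carries x k ≡ c k
      carries≡c zero    = trans (carry-0 xs) (trans sum≡ (sym start))
      carries≡c (suc k) = *-cancelˡ-≡ _ _ b (+-cancelˡ-≡ (m k) _ _ (begin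
        m k + b * carry (suc k) xs                     ≡⟨ cong (_+ b * carry (suc k) xs) (mult k) ⟨
        multiplicity (b ^ k) xs + b * carry (suc k) xs ≡⟨ carry-rec (expand-powers m n) k ⟨
        carry k xs                                     ≡⟨ carries≡c k ⟩
        c k                                            ≡⟨ rec k ⟩
        m k + b * c (suc k)                            ∎))

    -- Covers `_⊓_` and `_⊔_` at once: the inequalities are built from `b *_` and `_+ t`, which
    -- commute with both operations, and both are monotone. Idempotence handles the two equations.
    isCarrySequence-pointwise : (_∙_ : Op₂ ℕ) → Idempotent _≡_ _∙_ →
      (∀ {i j k l} → i ≤ j → k ≤ l → i ∙ k ≤ j ∙ l) →
      (∀ i j → b * (i ∙ j) ≡ (b * i) ∙ (b * j)) →
      (∀ i j → (i ∙ j) + t ≡ (i + t) ∙ (j + t)) →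
      ∀ {c c′} → IsCarrySequence c → IsCarrySequence c′ → IsCarrySequence (λ k → c k ∙ c′ k)
    isCarrySequence-pointwise _∙_ idem mono distrib* distrib+ {c} {c′} C C′ = record
      { start    = trans (cong₂ _∙_ C.start C′.start) (idem n)
      ; vanishes = λ n≤k → trans (cong₂ _∙_ (C.vanishes n≤k) (C′.vanishes n≤k)) (idem 0)
      ; lower    = λ k → ≤-trans (≤-reflexive (distrib* (c (suc k)) (c′ (suc k))))
                                 (mono (C.lower k) (C′.lower k))
      ; upper    = λ k → ≤-trans (mono (C.upper k) (C′.upper k))
                           (≤-reflexive (trans (sym (distrib+ (b * c (suc k)) _))
                             (cong (_+ t) (sym (distrib* (c (suc k)) (c′ (suc k)))))))
      }
      where
      module C  = IsCarrySequence C
      module C′ = IsCarrySequence C′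

    ≤ᴴ⇒carries-≥ : ∀ (x y : HyperPartition b t n) → x ≤ᴴ y → ∀ k → carries y k ≤ carries x k
    ≤ᴴ⇒carries-≥ _ _ x≤y k = quotientSum-≼ (b ^ k) {{m^n≢0 b k}} x≤y

    carries-≥⇒≤ᴴ : ∀ (x y : HyperPartition b t n) → (∀ k → carries y k ≤ carries x k) → x ≤ᴴ y
    carries-≥⇒≤ᴴ x y = carry-≤⇒≼ (powers y) (powers x)
      (trans (sum≡n (partition y)) (sym (sum≡n (partition x))))

    private
      -- Finer partitions are larger but have smaller carries, so the join takes the minimum.
      joinOf : ∀ x y → ∃ λ z → ∀ k → carries z k ≡ carries x k ⊓ carries y k
      joinOf x y = fromCarries (isCarrySequence-pointwise _⊓_ ⊓-idem ⊓-mono-≤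
        (*-distribˡ-⊓ b) (+-distribʳ-⊓ t) (carries-isCarrySequence x) (carries-isCarrySequence y))

      meetOf : ∀ x y → ∃ λ z → ∀ k → carries z k ≡ carries x k ⊔ carries y k
      meetOf x y = fromCarries (isCarrySequence-pointwise _⊔_ ⊔-idem ⊔-mono-≤
        (*-distribˡ-⊔ b) (+-distribʳ-⊔ t) (carries-isCarrySequence x) (carries-isCarrySequence y))

    join meet : Op₂ (HyperPartition b t n)
    join x y = proj₁ (joinOf x y)
    meet x y = proj₁ (meetOf x y)

    isLattice : IsLattice _≈ᴴ_ _≤ᴴ_ join meet
    isLattice = record
      { isPartialOrder = record
        { isPreorder = ≤ᴴ-isPreorder
        ; antisym = λ {x} {y} x≤y y≤x → carry-determines (powers x) (powers y) λ k →
            ≤-antisym (≤ᴴ⇒carries-≥ y x y≤x k) (≤ᴴ⇒carries-≥ x y x≤y k)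
        }
      ; supremum = λ x y →
          let eq = proj₂ (joinOf x y) in
          carries-≥⇒≤ᴴ x (join x y) (λ k → ≤-trans (≤-reflexive (eq k)) (m⊓n≤m _ _)) ,
          carries-≥⇒≤ᴴ y (join x y) (λ k → ≤-trans (≤-reflexive (eq k)) (m⊓n≤n _ _)) ,
          λ z x≤z y≤z → carries-≥⇒≤ᴴ (join x y) z λ k → ≤-trans
            (⊓-glb (≤ᴴ⇒carries-≥ x z x≤z k) (≤ᴴ⇒carries-≥ y z y≤z k))
            (≤-reflexive (sym (eq k)))
      ; infimum = λ x y →
          let eq = proj₂ (meetOf x y) in
          carries-≥⇒≤ᴴ (meet x y) x (λ k → ≤-trans (m≤m⊔n _ _) (≤-reflexive (sym (eq k)))) ,
          carries-≥⇒≤ᴴ (meet x y) y (λ k → ≤-trans (m≤n⊔m _ _) (≤-reflexive (sym (eq k)))) ,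
          λ z z≤x z≤y → carries-≥⇒≤ᴴ z (meet x y) λ k → ≤-trans (≤-reflexive (eq k))
            (⊔-lub (≤ᴴ⇒carries-≥ z x z≤x k) (≤ᴴ⇒carries-≥ z y z≤y k))
      }

-- The degenerate base 1.

all-1⇒≡replicate : ∀ {xs} → All (λ x → ∃[ j ] x ≡ 1 ^ j) xs → xs ≡ replicate (sum xs) 1
all-1⇒≡replicate []                = refl
all-1⇒≡replicate ((j , refl) ∷ ps) rewrite ^-zeroˡ j = cong (1 ∷_) (all-1⇒≡replicate ps)

unary-≈ᴴ : ∀ {t n} (x y : HyperPartition 1 t n) → x ≈ᴴ y
unary-≈ᴴ x y = ↭-reflexive (trans (ones x) (sym (ones y)))
  where
  ones : ∀ x → parts (partition x) ≡ replicate _ 1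
  ones x = trans (all-1⇒≡replicate (powers x)) (cong (λ s → replicate s 1) (sum≡n (partition x)))

-- Any two elements are equivalent, so the first projection serves as both operations.
unary-isLattice : ∀ {t n} → IsLattice (_≈ᴴ_ {1} {t} {n}) _≤ᴴ_ (λ x _ → x) (λ x _ → x)
unary-isLattice = record
  { isPartialOrder = record
    { isPreorder = ≤ᴴ-isPreorder
    ; antisym = λ {x} {y} _ _ → unary-≈ᴴ x y
    }
  ; supremum = λ x y → all≤ x x , all≤ y x , λ z _ _ → all≤ x z
  ; infimum  = λ x y → all≤ x x , all≤ x y , λ z _ _ → all≤ z x
  }
  where
  all≤ : ∀ x y → x ≤ᴴ y
  all≤ x y = ≼-reflexive (unary-≈ᴴ x y)

theorem3p7 : (b t n : ℕ) → .{{_ : NonZero b}} → .{{_ : NonZero t}} → .{{_ : NonZero n}} →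
    b ≤ t →
    ∃₂ λ (_∨_ _∧_ : Op₂ (HyperPartition b t n)) →
    IsLattice _≈ᴴ_ _≤ᴴ_ _∨_ _∧_
-- With base 1 all powers coincide, so exponents are not determined and carries never decay; this
-- base is split off.
theorem3p7 1               t n _ = _ , _ , unary-isLattice
theorem3p7 b@(suc (suc _)) t n _ = _ , _ , Base.isLattice b (s<s z<s)
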